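{- Let $p$ be a prime such that $p^* < p$. Then $p \mid \binom{0}{0}_F\binom{p^*}{1}_F$ but $p \nmid \binom{(p^*)^2}{p^*}_F$.
   Context: The Fibonacci sequence is $F_1=F_2=1$, $F_n=F_{n-1}+F_{n-2}$ for $n\ge 3$. For a prime $p$, $p^*$ denotes the least positive integer $n$ such that $p\mid F_n$ (it exists for every prime). The fibotorial is $n!_F = F_nF_{n-1}\cdots F_1$ for $n>0$, and $0!_F=1$. The fibonomial coefficient is $\binom{n}{k}_F=\frac{n!_F}{k!_F\,(n-k)!_F}$ for $0\le k\le n$, and $\binom{n}{k}_F=0$ otherwise; it is always an integer. -}

module Defs where

open import Data.Bool.Base using (if_then_else_)
open import Data.Fin.Base as Fin using (Fin; toℕ; combine)
open import Data.Fin.Properties using (pigeonhole; combine-injective; toℕ-fromℕ<)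
open import Data.Nat.Base
open import Data.Nat.Properties
open import Data.Nat.Divisibility
open import Data.Nat.DivMod
open import Data.Nat.Induction using (<-rec)
open import Data.Nat.Primality using (Prime; prime⇒nonZero)
open import Data.Nat.Tactic.RingSolver using (solve-∀)
open import Data.Product.Base using (∃; _×_; _,_; proj₁; proj₂)
open import Level using (0ℓ)
open import Relation.Binary.PropositionalEquality
open import Relation.Nullary.Decidable using (yes; no; _×-dec_)
open import Relation.Unary using (Pred; Decidable)

-- The extra value F 0 = 0 extends the recurrence F n = F (n - 1) + F (n - 2)
-- down to n = 2.
F : ℕ → ℕ
F 0             = 0
F 1             = 1
F (suc (suc n)) = F (suc n) + F n

F-nonZero : ∀ n → NonZero (F (suc n))
F-nonZero n = >-nonZero (pos n)
  where
  pos : ∀ n → 0 < F (suc n)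
  pos zero    = z<s
  pos (suc n) = <-≤-trans (pos n) (m≤m+n _ _)

infix 9 _!F

_!F : ℕ → ℕ
zero  !F = 1
suc n !F = F (suc n) * n !F

!F-nonZero : ∀ n → NonZero (n !F)
!F-nonZero zero    = _
!F-nonZero (suc n) = m*n≢0 (F (suc n)) (n !F) {{F-nonZero n}} {{ !F-nonZero n }}

-- For k ≤ n the denominator divides n !F, so rounding in _/_ never occurs.
fibonomial : ℕ → ℕ → ℕ
fibonomial n k = if k ≤ᵇ n then n !F / (k !F * (n ∸ k) !F) else 0
  where instance _ = m*n≢0 (k !F) ((n ∸ k) !F) {{ !F-nonZero k }} {{ !F-nonZero (n ∸ k) }}

IsLeast : Pred ℕ 0ℓ → Pred ℕ 0ℓ
IsLeast P n = P n × (∀ m → P m → n ≤ m)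

least : ∀ {P : Pred ℕ 0ℓ} → Decidable P → ∃ P → ∃ (IsLeast P)
least {P} P? (n , Pn) = <-rec (λ n → P n → ∃ (IsLeast P)) step n Pn
  where
  step : ∀ n → (∀ {m} → m < n → P m → ∃ (IsLeast P)) → P n → ∃ (IsLeast P)
  step n rec Pn with anyUpTo? P? n
  ... | yes (m , m<n , Pm) = rec m<n Pm
  ... | no ¬∃              = n , Pn , λ m Pm → ≮⇒≥ λ m<n → ¬∃ (m , m<n , Pm)

PositiveFibIndex : ℕ → Pred ℕ 0ℓ
PositiveFibIndex d n = 0 < n × d ∣ F n

-- By the pigeonhole principle two consecutive pairs (F i , F (i + 1)) and
-- (F j , F (j + 1)) with i < j agree modulo d; running the recurrence
-- backwards gives F (j - i) ≡ F 0 = 0.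
module _ (d : ℕ) .{{_ : NonZero d}} where

  private
    _≈_ : ℕ → ℕ → Set
    a ≈ b = ∃ λ x → ∃ λ y → a + x * d ≡ b + y * d

    mod⇒≈ : ∀ {a b} → a mod d ≡ b mod d → a ≈ b
    mod⇒≈ {a} {b} eq = b / d , a / d , (begin
      a + b / d * d                 ≡⟨ cong (_+ b / d * d) (m≡m%n+[m/n]*n a d) ⟩
      a % d + a / d * d + b / d * d ≡⟨ cong (λ r → r + a / d * d + b / d * d) %≡ ⟩
      b % d + a / d * d + b / d * d ≡⟨ swap (b % d) (a / d * d) (b / d * d) ⟩
      b % d + b / d * d + a / d * d ≡⟨ cong (_+ a / d * d) (m≡m%n+[m/n]*n b d) ⟨
      b + a / d * d                 ∎)
      where
      open ≡-Reasoning
      %≡ : a % d ≡ b % d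
      %≡ = begin
        a % d         ≡⟨ toℕ-fromℕ< (m%n<n a d) ⟨
        toℕ (a mod d) ≡⟨ cong toℕ eq ⟩
        toℕ (b mod d) ≡⟨ toℕ-fromℕ< (m%n<n b d) ⟩
        b % d         ∎
      swap : ∀ r s t → r + s + t ≡ r + t + s
      swap = solve-∀

    cancel : ∀ {a a′ b b′} → (b + a) ≈ (b′ + a′) → b ≈ b′ → a ≈ a′
    cancel {a} {a′} {b} {b′} (x , y , e) (z , w , e′) =
      x + w , y + z , +-cancelˡ-≡ (b + b′) _ _ (begin
        b + b′ + (a + (x + w) * d)        ≡⟨ lhs a b b′ x w d ⟩
        (b + a + x * d) + (b′ + w * d)    ≡⟨ cong₂ _+_ e (sym e′) ⟩
        (b′ + a′ + y * d) + (b + z * d)   ≡⟨ rhs a′ b b′ y z d ⟩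
        b + b′ + (a′ + (y + z) * d)       ∎)
      where
      open ≡-Reasoning
      lhs : ∀ a b b′ x w d → b + b′ + (a + (x + w) * d) ≡ (b + a + x * d) + (b′ + w * d)
      lhs = solve-∀
      rhs : ∀ a b b′ y z d → (b′ + a + y * d) + (b + z * d) ≡ b + b′ + (a + (y + z) * d)
      rhs = solve-∀

    descend : ∀ i k → F i ≈ F (i + k) → F (suc i) ≈ F (suc i + k) → d ∣ F k
    descend zero k (x , y , e) _ =
      ∣m+n∣m⇒∣n (subst (d ∣_) (trans e (+-comm (F k) (y * d))) (n∣m*n x)) (n∣m*n y)
    descend (suc i) k e₁ e₂ = descend i k (cancel e₂ e₁) e₁

  ∃-positiveFibIndex : ∃ (PositiveFibIndex d)
  ∃-positiveFibIndex with pigeonhole (n<1+n (d * d))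
                            (λ (i : Fin (suc (d * d))) → combine (F (toℕ i) mod d) (F (suc (toℕ i)) mod d))
  ... | i , j , i<j , eq with combine-injective (F (toℕ i) mod d) _ (F (toℕ j) mod d) _ eq
  ... | eq₁ , eq₂ = toℕ j ∸ toℕ i , m<n⇒0<n∸m i<j ,
        descend (toℕ i) (toℕ j ∸ toℕ i)
          (subst (λ m → F (toℕ i) ≈ F m) j≡ (mod⇒≈ eq₁))
          (subst (λ m → F (suc (toℕ i)) ≈ F (suc m)) j≡ (mod⇒≈ eq₂))
    where
    j≡ : toℕ j ≡ toℕ i + (toℕ j ∸ toℕ i)
    j≡ = sym (m+[n∸m]≡n (<⇒≤ i<j))

leastFibIndex : ∀ {p} → Prime p → ∃ (IsLeast (PositiveFibIndex p))
leastFibIndex {p} p-prime =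
  least (λ n → (0 <? n) ×-dec (p ∣? F n)) (∃-positiveFibIndex p)
  where instance _ = prime⇒nonZero p-prime

-- The number p*; the prime p is implicit in the primality proof.
rank : ∀ {p} → Prime p → ℕ
rank p-prime = proj₁ (leastFibIndex p-prime)

rank-isLeast : ∀ {p} (p-prime : Prime p) → IsLeast (PositiveFibIndex p) (rank p-prime)
rank-isLeast p-prime = proj₂ (leastFibIndex p-prime)

{-# OPTIONS --safe #-}
-- Write r = p* and n = r².  In the fraction F n ⋯ F (n - r + 1) / (F r ⋯ F 1) the
-- numerator and the denominator each have exactly one factor divisible by p, namely
-- F n and F r.  Modulo p, F (m r) / F r ≡ m F (r - 1) ^ (m - 1), so for m = r their
-- quotient is a unit: 0 < r < p, and p does not divide two consecutive Fibonacci numbers.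
module Submission where

open import Defs
open import Data.Nat.Base using (ℕ; zero; suc; _+_; _∸_; _*_; _^_; _≤_; _<_; _≤ᵇ_; z≤n; z<s; s≤s; nonTrivial⇒≢1)
open import Data.Nat.Divisibility using (_∣_; _∤_; divides; ∣-reflexive; ∣1⇒≡1; ∣⇒≤; ∣m∣n⇒∣m+n; ∣m+n∣m⇒∣n; ∣m⇒∣m*n; ∣n⇒∣m*n; n∣m*n; *-monoʳ-∣)
open import Data.Nat.DivMod using (m/n*n≡m)
open import Data.Nat.Primality using (Prime; euclidsLemma; prime⇒nonTrivial)
open import Data.Nat.Properties using (*-assoc; *-identityˡ; *-identityʳ; *-cancelʳ-≡; +-comm; +-identityʳ; +-suc; m≤m+n; m+n∸m≡n; m+[n∸m]≡n; m≤n⇒m≤1+n; <⇒≱; ≤-refl; ≤⇒≤ᵇ; m*n≢0)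
open import Data.Bool.Base using (true)
open import Data.Nat.Tactic.RingSolver using (solve-∀)
open import Data.Product.Base using (∃; _×_; _,_)
open import Data.Sum.Base using ([_,_]′)
open import Function.Base using (_∘_)
open import Relation.Binary.PropositionalEquality

∣m+n∣n⇒∣m : ∀ {d m n} → d ∣ m + n → d ∣ n → d ∣ m
∣m+n∣n⇒∣m {d} {m} {n} d∣m+n = ∣m+n∣m⇒∣n (subst (d ∣_) (+-comm m n) d∣m+n)

-- Both sides obey the Fibonacci recurrence in `m`, so two base cases suffice.
F-+ : ∀ m n → F (m + suc n) ≡ F (suc m) * F (suc n) + F m * F n
F-+ zero n = id₀ (F (suc n)) (F n)
  where
  id₀ : ∀ x y → x ≡ 1 * x + 0 * y
  id₀ = solve-∀
F-+ (suc zero) n = id₁ (F (suc n)) (F n)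
  where
  id₁ : ∀ x y → x + y ≡ 1 * x + 1 * y
  id₁ = solve-∀
F-+ (suc (suc m)) n =
  trans (cong₂ _+_ (F-+ (suc m) n) (F-+ m n))
        (regroup (F (suc m)) (F m) (F (suc n)) (F n))
  where
  regroup : ∀ a b x y → ((a + b) * x + a * y) + (a * x + b * y) ≡ (a + b + a) * x + (a + b) * y
  regroup = solve-∀

-- A Pascal rule: `F-+` splits the top factor of `(suc m + suc n) !F` into two terms, and induction
-- handles one with `n` lowered and the other with `m` lowered. This makes the quotient in
-- `fibonomial` exact.
!F*!F∣!F : ∀ m n → m !F * n !F ∣ (m + n) !F
!F*!F∣!F zero n = ∣-reflexive (*-identityˡ (n !F))
!F*!F∣!F (suc m) zero =
  subst (λ k → suc m !F * 1 ∣ k !F) (sym (+-identityʳ (suc m))) (∣-reflexive (*-identityʳ (suc m !F)))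
!F*!F∣!F (suc m) (suc n) = subst (suc m !F * suc n !F ∣_) (sym split) (∣m∣n⇒∣m+n left right)
  where
  N = (m + suc n) !F

  exchange : ∀ a b c → a * (b * c) ≡ b * (a * c)
  exchange = solve-∀
  distrib : ∀ a b c d x → (a * b + c * d) * x ≡ a * (b * x) + d * (c * x)
  distrib = solve-∀

  split : (suc m + suc n) !F ≡ F (2 + m) * (F (suc n) * N) + F n * (F (suc m) * N)
  split = trans (cong (_* N) (F-+ (suc m) n)) (distrib (F (2 + m)) (F (suc n)) (F (suc m)) (F n) N)

  left : suc m !F * suc n !F ∣ F (2 + m) * (F (suc n) * N)
  left = ∣n⇒∣m*n (F (2 + m)) (subst (_∣ F (suc n) * N) (exchange (F (suc n)) (suc m !F) (n !F))
    (*-monoʳ-∣ (F (suc n)) (subst (λ k → suc m !F * n !F ∣ k !F) (sym (+-suc m n)) (!F*!F∣!F (suc m) n))))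

  right : suc m !F * suc n !F ∣ F n * (F (suc m) * N)
  right = ∣n⇒∣m*n (F n) (subst (_∣ F (suc m) * N) (sym (*-assoc (F (suc m)) (m !F) (suc n !F)))
    (*-monoʳ-∣ (F (suc m)) (!F*!F∣!F m (suc n))))

fibonomial-* : ∀ n k → k ≤ n → fibonomial n k * (k !F * (n ∸ k) !F) ≡ n !F
fibonomial-* n k k≤n with k ≤ᵇ n | ≤⇒≤ᵇ k≤n
-- The `false` case is empty, since `≤⇒≤ᵇ k≤n` would inhabit `T false`.
... | true | _ = m/n*n≡m (subst (λ j → k !F * (n ∸ k) !F ∣ j !F) (m+[n∸m]≡n k≤n) (!F*!F∣!F k (n ∸ k)))
  where
  instance _ = m*n≢0 (k !F) ((n ∸ k) !F) {{ !F-nonZero k }} {{ !F-nonZero (n ∸ k) }}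

fibonomial-1 : ∀ n → fibonomial (suc n) 1 ≡ F (suc n)
fibonomial-1 n = *-cancelʳ-≡ _ _ (n !F) {{ !F-nonZero n }}
  (trans (cong (fibonomial (suc n) 1 *_) (sym (*-identityˡ (n !F))))
         (fibonomial-* (suc n) 1 (s≤s z≤n)))

infix 9 _!F↑_

-- The product F (n + 1) ⋯ F (n + k): the numerator of a fibonomial once `n !F` is cancelled.
_!F↑_ : ℕ → ℕ → ℕ
n !F↑ zero  = 1
n !F↑ suc k = F (suc k + n) * n !F↑ k

!F-+ : ∀ k n → (k + n) !F ≡ n !F↑ k * n !F
!F-+ zero    n = sym (*-identityˡ _)
!F-+ (suc k) n = trans (cong (F (suc k + n) *_) (!F-+ k n)) (sym (*-assoc (F (suc k + n)) _ _))

fibonomial-!F↑ : ∀ k n → fibonomial (k + n) k * k !F ≡ n !F↑ k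
fibonomial-!F↑ k n = *-cancelʳ-≡ _ _ (n !F) {{ !F-nonZero n }} (begin
  fibonomial (k + n) k * k !F * n !F             ≡⟨ *-assoc (fibonomial (k + n) k) _ _ ⟩
  fibonomial (k + n) k * (k !F * n !F)           ≡⟨ cong (λ j → fibonomial (k + n) k * (k !F * j !F)) (m+n∸m≡n k n) ⟨
  fibonomial (k + n) k * (k !F * (k + n ∸ k) !F) ≡⟨ fibonomial-* (k + n) k (m≤m+n k n) ⟩
  (k + n) !F                                     ≡⟨ !F-+ k n ⟩
  n !F↑ k * n !F                                 ∎)
  where open ≡-Reasoning

-- Running the recurrence backwards carries the common divisor down to F 1 = 1.
∣F-consecutive⇒∣1 : ∀ {d} n → d ∣ F n → d ∣ F (suc n) → d ∣ 1
∣F-consecutive⇒∣1 zero    _ d∣F₁ = d∣F₁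
∣F-consecutive⇒∣1 (suc n) d∣Fₙ₊₁ d∣Fₙ₊₂ = ∣F-consecutive⇒∣1 n (∣m+n∣m⇒∣n d∣Fₙ₊₂ d∣Fₙ₊₁) d∣Fₙ₊₁

-- Here r = suc s, and d ∣ F r gives F (r + 1) ≡ F s modulo d, the base of the powers below.
module _ {d s : ℕ} where

  F[1+m*r]≡ : d ∣ F (suc s) → ∀ m → ∃ λ k → F (suc (m * suc s)) ≡ F s ^ m + k * d
  F[1+m*r]≡ _ zero = 0 , refl
  F[1+m*r]≡ d∣Fᵣ@(divides c Fᵣ≡) (suc m) with F[1+m*r]≡ d∣Fᵣ m
  ... | k , eq = c * (F s ^ m + k * d) + F s * k + c * F (m * suc s) , (begin
    F (suc (suc s + m * suc s))                          ≡⟨ cong F (+-suc (suc s) (m * suc s)) ⟨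
    F (suc s + suc (m * suc s))                          ≡⟨ F-+ (suc s) (m * suc s) ⟩
    (F (suc s) + F s) * F (suc (m * suc s)) + F (suc s) * F (m * suc s)
      ≡⟨ cong₂ (λ x y → (x + F s) * y + x * F (m * suc s)) Fᵣ≡ eq ⟩
    (c * d + F s) * (F s ^ m + k * d) + c * d * F (m * suc s)
      ≡⟨ collect c d (F s) (F s ^ m) k (F (m * suc s)) ⟩
    F s * F s ^ m + (c * (F s ^ m + k * d) + F s * k + c * F (m * suc s)) * d ∎)
    where
    open ≡-Reasoning
    collect : ∀ c d a b k f → (c * d + a) * (b + k * d) + c * d * f ≡ a * b + (c * (b + k * d) + a * k + c * f) * d
    collect = solve-∀

  -- Modulo `d` both sides vanish, so the factor F r is kept explicit and the congruence concerns
  -- its cofactor. By `F-+`, passing to the next multiple of r multiplies the old cofactor by `F s`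
  -- and adds F (m r + 1), a power of `F s` modulo `d`.
  F[m*r]≡ : d ∣ F (suc s) → ∀ m → ∃ λ k → F (suc m * suc s) ≡ (suc m * F s ^ m + k * d) * F (suc s)
  F[m*r]≡ _ zero = 0 , trans (cong F (+-identityʳ (suc s))) (sym (*-identityˡ _))
  F[m*r]≡ d∣Fᵣ (suc m) with F[1+m*r]≡ d∣Fᵣ (suc m) | F[m*r]≡ d∣Fᵣ m
  ... | j , eq₁ | k , eq₂ = j + k * F s , (begin
    F (suc s + suc m * suc s)
      ≡⟨ cong F (+-comm (suc s) (suc m * suc s)) ⟩
    F (suc m * suc s + suc s)
      ≡⟨ F-+ (suc m * suc s) s ⟩
    F (suc (suc m * suc s)) * F (suc s) + F (suc m * suc s) * F s
      ≡⟨ cong₂ (λ x y → x * F (suc s) + y * F s) eq₁ eq₂ ⟩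
    (F s * F s ^ m + j * d) * F (suc s) + (suc m * F s ^ m + k * d) * F (suc s) * F s
      ≡⟨ collect m (F s) (F s ^ m) j k d (F (suc s)) ⟩
    (suc (suc m) * (F s * F s ^ m) + (j + k * F s) * d) * F (suc s) ∎)
    where
    open ≡-Reasoning
    collect : ∀ m a b j k d f → (a * b + j * d) * f + (suc m * b + k * d) * f * a ≡ (suc (suc m) * (a * b) + (j + k * a) * d) * f
    collect = solve-∀

  ∣F-multiple : d ∣ F (suc s) → ∀ m → d ∣ F (m * suc s)
  ∣F-multiple _    zero    = divides 0 refl
  ∣F-multiple d∣Fᵣ (suc m) with F[m*r]≡ d∣Fᵣ m
  ... | k , eq = subst (d ∣_) (sym eq) (∣n⇒∣m*n (suc m * F s ^ m + k * d) d∣Fᵣ)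

module _ {p : ℕ} (p-prime : Prime p) where

  p∤1 : p ∤ 1
  p∤1 = nonTrivial⇒≢1 {{prime⇒nonTrivial p-prime}} ∘ ∣1⇒≡1

  ∤-* : ∀ {m n} → p ∤ m → p ∤ n → p ∤ m * n
  ∤-* {m} {n} p∤m p∤n = [ p∤m , p∤n ]′ ∘ euclidsLemma m n p-prime

  ∤-^ : ∀ {m} → p ∤ m → ∀ k → p ∤ m ^ k
  ∤-^ p∤m zero    = p∤1
  ∤-^ p∤m (suc k) = ∤-* p∤m (∤-^ p∤m k)

  -- Modulo `p`, `F-+` reduces to F (n + i + 1) ≡ F (n + 1) F (i + 1), and F (n + 1) is a unit
  -- because its neighbour F n is divisible by `p`.
  ∤F-shift : ∀ {n} i → p ∣ F n → p ∤ F (suc i) → p ∤ F (suc i + n)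
  ∤F-shift {n} i p∣Fₙ p∤Fᵢ p∣F = ∤-* (p∤1 ∘ ∣F-consecutive⇒∣1 n p∣Fₙ) p∤Fᵢ
    (∣m+n∣n⇒∣m (subst (p ∣_) (trans (cong F (+-comm (suc i) n)) (F-+ n i)) p∣F) (∣m⇒∣m*n (F i) p∣Fₙ))

  ∤-!F↑ : ∀ {n} k → p ∣ F n → (∀ i → i < k → p ∤ F (suc i)) → p ∤ n !F↑ k
  ∤-!F↑ zero    _    _  = p∤1
  ∤-!F↑ (suc k) p∣Fₙ p∤ = ∤-* (∤F-shift k p∣Fₙ (p∤ k ≤-refl)) (∤-!F↑ k p∣Fₙ (λ i i<k → p∤ i (m≤n⇒m≤1+n i<k)))

  ∤fibonomial-r² : ∀ s → IsLeast (PositiveFibIndex p) (suc s) → suc s < p →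
                   p ∤ fibonomial (suc s * suc s) (suc s)
  ∤fibonomial-r² s ((_ , p∣Fᵣ) , minimal) r<p p∣B with F[m*r]≡ {p} {s} p∣Fᵣ s
  ... | k , F[r²]≡ = ∤-* p∤q p∤rest (subst (p ∣_) B*s!≡ (∣m⇒∣m*n (s !F) p∣B))
    where
    open ≡-Reasoning
    B    = fibonomial (suc s * suc s) (suc s)
    q    = suc s * F s ^ s + k * p
    rest = (s * suc s) !F↑ s

    p∤Fₛ : p ∤ F s
    p∤Fₛ p∣Fₛ = p∤1 (∣F-consecutive⇒∣1 s p∣Fₛ p∣Fᵣ)

    -- Modulo `p`, `q` is r F s ^ s; the bound r < p makes the factor r a unit.
    p∤q : p ∤ q
    p∤q p∣q = ∤-* (λ p∣r → <⇒≱ r<p (∣⇒≤ p∣r)) (∤-^ p∤Fₛ s) (∣m+n∣n⇒∣m p∣q (n∣m*n k))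

    -- The factors of `rest` have indices s r + 1, ..., s r + s, and minimality of r covers the
    -- shifts 1, ..., s.
    p∤rest : p ∤ rest
    p∤rest = ∤-!F↑ s (∣F-multiple p∣Fᵣ s) λ i i<s p∣Fᵢ → <⇒≱ (s≤s i<s) (minimal (suc i) (z<s , p∣Fᵢ))

    move : ∀ b f x → b * x * f ≡ b * (f * x)
    move = solve-∀
    move′ : ∀ b f x → b * f * x ≡ b * x * f
    move′ = solve-∀

    -- The top factor F (r²) of the numerator is `q` times F r, the top factor of the denominator;
    -- cancelling F r leaves this identity.
    B*s!≡ : B * s !F ≡ q * rest
    B*s!≡ = *-cancelʳ-≡ _ _ (F (suc s)) {{F-nonZero s}} (begin
      B * s !F * F (suc s)       ≡⟨ move B (F (suc s)) (s !F) ⟩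
      B * (F (suc s) * s !F)     ≡⟨ fibonomial-!F↑ (suc s) (s * suc s) ⟩
      F (suc s * suc s) * rest   ≡⟨ cong (_* rest) F[r²]≡ ⟩
      q * F (suc s) * rest       ≡⟨ move′ q (F (suc s)) rest ⟩
      q * rest * F (suc s)       ∎)

  -- Stated for a variable `r` instead of `rank p-prime`, so that it can be matched as `suc s`.
  fibonomial-leastIndex : ∀ r → IsLeast (PositiveFibIndex p) r → r < p →
    (p ∣ fibonomial 0 0 * fibonomial r 1) × (p ∤ fibonomial (r ^ 2) r)
  fibonomial-leastIndex zero    ((() , _) , _)
  fibonomial-leastIndex (suc s) least@((_ , p∣Fᵣ) , _) r<p =
    ∣n⇒∣m*n (fibonomial 0 0) (subst (p ∣_) (sym (fibonomial-1 s)) p∣Fᵣ) ,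
    subst (λ n → p ∤ fibonomial n (suc s)) (sym (cong (suc s *_) (*-identityʳ (suc s))))
          (∤fibonomial-r² s least r<p)

theorem4p3 : (p : ℕ) (p-prime : Prime p) → rank p-prime < p →
    (p ∣ fibonomial 0 0 * fibonomial (rank p-prime) 1) ×
    (p ∤ fibonomial (rank p-prime ^ 2) (rank p-prime))
theorem4p3 p p-prime = fibonomial-leastIndex p-prime (rank p-prime) (rank-isLeast p-prime)
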